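{- Let $\mathrm{a}_{n,k}^{\mathrm{dasc}}(132,321)$ denote the number of permutations of $\{1,\dots,n\}$ that avoid both $132$ and $321$ and have exactly $k$ double ascents. Then $$\mathrm{a}_{n,k}^{\mathrm{dasc}}(132,321)=\begin{cases}1,&k=n-2;\\ n,&k=n-3;\\ \binom{n}{2}-n,&k=n-4;\\ 0,&\text{otherwise}.\end{cases}$$
   Context: $\mathcal{S}_n$ is the set of permutations $\pi=\pi_1\cdots\pi_n$ of $\{1,\dots,n\}$. For $\rho\in\mathcal{S}_m$, $\pi\in\mathcal{S}_n$ contains $\rho$ if there are indices $1\le i_1<\cdots<i_m\le n$ such that $\pi_{i_a}<\pi_{i_b}$ if and only if $\rho_a<\rho_b$; otherwise $\pi$ avoids $\rho$. The number of double ascents is $\mathrm{dasc}(\pi)=|\{i:\pi_i<\pi_{i+1}\text{ and }\pi_{i+1}<\pi_{i+2}\}|$, where $1\le i\le n-2$.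
   Formalization: The formal theorem assumes n ≥ 3, because the displayed formula fails for smaller n: for n = 2, k = 0 the count is 2 rather than 1, and for n = 0 or 1, k = 0 the count is 1 rather than 0. -}

module Defs where

open import Data.Fin.Base using (Fin; suc; inject₁; _<_)
open import Data.Fin.Patterns using (0F; 1F; 2F)
open import Data.Fin.Permutation using (Permutation′; _⟨$⟩ʳ_; transpose; reverse)
open import Data.Fin.Properties using (_<?_)
open import Data.List.Base using (length; filter; allFin)
open import Data.Nat.Base using (ℕ; zero; suc)
open import Data.Product.Base using (Σ; ∃; _×_; _,_)
open import Data.Vec.Base using (Vec; []; _∷_; tabulate)
open import Function.Bundles using (_⇔_; Inverse)
open import Level using (0ℓ)
open import Relation.Binary.Bundles using (Setoid)
import Relation.Binary.Construct.On as On
open import Relation.Binary.PropositionalEquality using (_≡_; refl; setoid; _→-setoid_)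
open import Relation.Nullary.Decidable using (_×-dec_)
open import Relation.Nullary.Negation using (¬_)

private
  variable
    l m n : ℕ

-- Positions and values are numbered from 0, so the one-line notation of π is
-- π ⟨$⟩ʳ 0, …, π ⟨$⟩ʳ (n - 1), with every value lowered by one.

_Contains_ : Permutation′ n → Permutation′ m → Set
_Contains_ {n} {m} π ρ =
  ∃ λ (i : Fin m → Fin n) →
      (∀ a b → a < b → i a < i b)
    × (∀ a b → (π ⟨$⟩ʳ i a < π ⟨$⟩ʳ i b) ⇔ (ρ ⟨$⟩ʳ a < ρ ⟨$⟩ʳ b))

_Avoids_ : Permutation′ n → Permutation′ m → Set
π Avoids ρ = ¬ (π Contains ρ)

-- For n = 2 + m and i : Fin m, the positions i, i + 1, i + 2 of Fin n are
-- inject₁ (inject₁ i), suc (inject₁ i), suc (suc i).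
dasc : Permutation′ n → ℕ
dasc {zero}        π = 0
dasc {suc zero}    π = 0
dasc {suc (suc m)} π = length (filter doubleAscent? (allFin m))
  where
  doubleAscent? = λ (i : Fin m) →
          (π ⟨$⟩ʳ inject₁ (inject₁ i) <? π ⟨$⟩ʳ suc (inject₁ i))
    ×-dec (π ⟨$⟩ʳ suc (inject₁ i) <? π ⟨$⟩ʳ suc (suc i))

p132 p321 : Permutation′ 3
p132 = transpose 1F 2F
p321 = reverse

private
  oneLine : Permutation′ n → Vec (Fin n) n
  oneLine π = tabulate (π ⟨$⟩ʳ_)

  _ : oneLine p132 ≡ 0F ∷ 2F ∷ 1F ∷ []
  _ = refl

  _ : oneLine p321 ≡ 2F ∷ 1F ∷ 0F ∷ []
  _ = refl

-- A setoid rather than a type: two elements are identified when they are the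
-- same permutation pointwise, whatever their inverses and avoidance proofs.
AvoidersWithDasc : Permutation′ l → Permutation′ m → ℕ → ℕ → Setoid 0ℓ 0ℓ
AvoidersWithDasc ρ σ n k =
  On.setoid {B = Σ (Permutation′ n) λ π → π Avoids ρ × π Avoids σ × dasc π ≡ k}
            (Fin n →-setoid Fin n)
            (λ (π , _) → π ⟨$⟩ʳ_)

infix 4 _HasCardinality_

_HasCardinality_ : Setoid 0ℓ 0ℓ → ℕ → Set
S HasCardinality c = Inverse S (setoid (Fin c))

{-# OPTIONS --safe #-}

-- Let a be the position of the value 0 and b the value at position 0. Avoiding 321 (with 0 as
-- its last value) makes the values before position a increase, avoiding 132 (with b, resp. 0, as
-- its first value) forbids skipping a value that comes later. Hence the permutation is
--   b, …, b + a - 1, 0, …, b - 1, a + b, a + b + 1, …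
-- Conversely all these permutations avoid both patterns. If a > 0, the only descent ends at
-- position a, so there are increasing runs of lengths a and n - a, and the number of double
-- ascents is (a ∸ 2) + (n - a ∸ 2). It equals n - 2 only for the identity a = b = 0,
-- n - 3 when one of the runs has length 1, and n - 4 otherwise.
module Submission where

open import Defs
open import Data.Nat.Base using (ℕ; _+_; _∸_; _≤_)
open import Data.Nat.Combinatorics using (_C_)
open import Data.Product.Base using (_×_)
open import Relation.Binary.PropositionalEquality using (_≡_; _≢_)

open import Data.Fin.Base as Fin using (Fin; toℕ; fromℕ<; inject₁)
open import Data.Fin.Induction using (<-wellFounded)
open import Data.Fin.Patterns using (0F; 1F; 2F)
open import Data.Fin.Permutation
  using (Permutation′; _⟨$⟩ʳ_; _⟨$⟩ˡ_; permutation; inverseʳ)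
open import Data.Fin.Properties
  using (toℕ-injective; toℕ-fromℕ<; toℕ-inject₁; toℕ<n; +↔⊎)
open import Data.List.Base using (length; filter; tabulate)
open import Data.List.Properties using (filter-accept; filter-reject)
open import Data.Nat.Base using (zero; suc; _<_; z≤n; s≤s; s≤s⁻¹; z<s; >-nonZero)
open import Data.Nat.Combinatorics using (nC1≡n; nCk+nC[k+1]≡[n+1]C[k+1])
open import Data.Nat.Properties
open import Data.Nat.Tactic.RingSolver using (solve-∀)
open import Data.Product.Base using (Σ; ∃; ∃₂; _,_; proj₁; proj₂)
open import Data.Sum.Base using (_⊎_; inj₁; inj₂)
open import Data.Sum.Function.Propositional using (_⊎-↔_)
import Data.Vec.Functional as Vector
open import Function.Base using (_∘_)
open import Function.Bundles using (Equivalence; Inverse; Injection; _↔_; mk↔ₛ′; mk⇔)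
open import Function.Construct.Composition using (inverse)
open import Function.Properties.Bijection using (Bijection⇒Inverse)
open import Function.Properties.Inverse using (↔⇒↣; ↔-refl; ↔-sym; ↔-trans)
  renaming (sym to Inverse-sym)
open import Induction.WellFounded using (Acc; acc)
open import Level using (0ℓ)
open import Relation.Binary.Bundles using (Setoid)
open import Relation.Binary.Definitions using (Tri; tri<; tri≈; tri>)
open import Relation.Binary.PropositionalEquality
  using (refl; sym; trans; cong; subst; subst₂; setoid; module ≡-Reasoning)
open import Relation.Nullary.Decidable using (Dec; yes; no)
open import Relation.Nullary.Negation using (¬_; contradiction)
open import Relation.Unary using (Pred; Decidable)

private
  variable
    a b i j k m n p v w : ℕ

-- Graphs of block permutations

+-comm-≤ : ∀ a b → a + b ≤ n → b + a ≤ n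
+-comm-≤ a b = ≤-trans (≤-reflexive (+-comm b a))

-- The graph of b, b + 1, …, b + a - 1, 0, 1, …, b - 1, a + b, a + b + 1, …
data Block (a b i v : ℕ) : Set where
  low  : i < a → b + i ≡ v → Block a b i v
  mid  : v < b → a + v ≡ i → Block a b i v
  high : a + b ≤ i → i ≡ v → Block a b i v

-- Reflecting the graph in the diagonal exchanges `low` and `mid`, so the inverse of the permutation
-- with parameters `a`, `b` has parameters `b`, `a`. Facts about positions thus follow from facts
-- about values.
block-swap : Block a b i v → Block b a v i
block-swap                 (low i<a eq)      = mid i<a eq
block-swap                 (mid v<b eq)      = low v<b eq
block-swap {a} {b}         (high a+b≤i refl) = high (+-comm-≤ a b a+b≤i) refl

block-respˡ : i ≡ j → Block a b i v → Block a b j v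
block-respˡ refl B = B

block-respʳ : v ≡ w → Block a b i v → Block a b i w
block-respʳ refl B = B

block-image : ∀ a b i → ∃ (Block a b i)
block-image a b i with i <? a | i <? a + b
... | yes i<a | _         = b + i , low i<a refl
... | no i≮a  | yes i<a+b =
  i ∸ a , mid (m<n+o⇒m∸n<o i a ⦃ b>0 ⦄ i<a+b) (m+[n∸m]≡n (≮⇒≥ i≮a))
  where
  -- Here `a + 0 = a ≤ i < a + b`.
  b>0 = >-nonZero (+-cancelˡ-< a 0 b (subst (_< a + b) (sym (+-identityʳ a)) (≤-<-trans (≮⇒≥ i≮a) i<a+b)))
... | no _    | no i≮a+b  = i , high (≮⇒≥ i≮a+b) refl

block-functional : Block a b i v → Block a b i w → v ≡ w
block-functional     (low _ refl)   (low _ refl)   = refl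
block-functional     (low i<a _)    (mid _ refl)   = contradiction i<a (m+n≮m _ _)
block-functional     (low i<a _)    (high a+b≤i _) = contradiction i<a (≤⇒≯ (m+n≤o⇒m≤o _ a+b≤i))
block-functional     (mid _ refl)   (low i<a _)    = contradiction i<a (m+n≮m _ _)
block-functional {a} (mid _ eq)     (mid _ eq′)    = +-cancelˡ-≡ a _ _ (trans eq (sym eq′))
block-functional {a} (mid v<b refl) (high a+b≤i _) = contradiction (+-cancelˡ-≤ a _ _ a+b≤i) (<⇒≱ v<b)
block-functional     (high a+b≤i _) (low i<a _)    = contradiction i<a (≤⇒≯ (m+n≤o⇒m≤o _ a+b≤i))
block-functional {a} (high a+b≤i _) (mid v<b refl) = contradiction (+-cancelˡ-≤ a _ _ a+b≤i) (<⇒≱ v<b)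
block-functional     (high _ refl)  (high _ refl)  = refl

block-injective : Block a b i v → Block a b j v → i ≡ j
block-injective B B′ = block-functional (block-swap B) (block-swap B′)

block-bounded : a + b ≤ n → i < n → Block a b i v → v < n
block-bounded {a} {b} a+b≤n _   (low i<a refl) =
  <-≤-trans (+-monoʳ-< b i<a) (+-comm-≤ a b a+b≤n)
block-bounded {a} {b} a+b≤n _   (mid v<b _)    = <-≤-trans v<b (m+n≤o⇒n≤o a a+b≤n)
block-bounded         _     i<n (high _ refl)  = i<n

block-low : i < a → Block a b i v → b ≤ v
block-low {b = b} i<a (low _ refl)    = m≤m+n b _
block-low         i<a (mid _ refl)    = contradiction i<a (m+n≮m _ _)
block-low         i<a (high a+b≤i _)  = contradiction i<a (≤⇒≯ (m+n≤o⇒m≤o _ a+b≤i))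

-- Values increase inside each block, and the high block exceeds the other two in both position and
-- value. An inversion can therefore only lead from the first block to the second; both avoidance
-- proofs and the location of the descent rest on this.
block-inversion : Block a b i v → Block a b j w → i < j → w < v → i < a × w < b
block-inversion {b = b} (low i<a refl) (low _ refl) i<j w<v =
  contradiction (+-cancelˡ-< b _ _ w<v) (<-asym i<j)
block-inversion (low i<a _) (mid w<b _) _ _ = i<a , w<b
block-inversion {a} {b} {i} (low i<a refl) (high a+b≤j refl) _ w<v =
  contradiction (<-≤-trans w<v (<⇒≤ (+-monoʳ-< b i<a)))
    (≤⇒≯ (+-comm-≤ a b a+b≤j))
block-inversion {a} (mid _ refl) (mid _ refl) i<j w<v =
  contradiction (+-cancelˡ-< a _ _ i<j) (<-asym w<v)
block-inversion {a} {b} (mid v<b _) (high a+b≤j refl) _ w<v =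
  contradiction (<-trans w<v v<b) (≤⇒≯ (m+n≤o⇒n≤o a a+b≤j))
block-inversion {a} (mid _ refl) (low j<a _) i<j _ =
  contradiction (<-trans i<j j<a) (m+n≮m _ _)
block-inversion (high a+b≤i _) (low j<a _) i<j _ =
  contradiction (<-trans i<j j<a) (≤⇒≯ (m+n≤o⇒m≤o _ a+b≤i))
block-inversion {a} (high a+b≤i _) (mid w<b refl) i<j _ =
  contradiction (<-trans (≤-<-trans a+b≤i i<j) (+-monoʳ-< a w<b)) (<-irrefl refl)
block-inversion (high _ refl) (high _ refl) i<j w<v = contradiction w<v (<-asym i<j)

-- The two implications make (0 , 0) the only parameters of the identity.
record Valid (n a b : ℕ) : Set where
  constructor valid
  field
    bounded : a + b ≤ n
    a>0⇒b>0 : 0 < a → 0 < b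
    b>0⇒a>0 : 0 < b → 0 < a

  -- This uses the implications: for `a = 0 < b` the graph would send 0 to 0 and not to `b`.
  first-value : Block a b 0 b
  first-value with 0 <? a
  ... | yes a>0 = low a>0 (+-identityʳ b)
  ... | no a≯0 = high (≤-reflexive (trans (cong (_+ b) a≡0) b≡0)) (sym b≡0)
    where
    a≡0 : a ≡ 0
    a≡0 = n≤0⇒n≡0 (≮⇒≥ a≯0)
    b≡0 : b ≡ 0
    b≡0 = n≤0⇒n≡0 (≮⇒≥ (a≯0 ∘ b>0⇒a>0))

open Valid

valid-swap : Valid n a b → Valid n b a
valid-swap {a = a} {b} V = record
  { bounded = +-comm-≤ a b (bounded V)
  ; a>0⇒b>0 = b>0⇒a>0 V
  ; b>0⇒a>0 = a>0⇒b>0 V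
  }

position-of-0 : Valid n a b → Block a b a 0
position-of-0 V = block-swap (first-value (valid-swap V))

-- Block permutations avoid both patterns

IsBlock : ℕ → ℕ → Permutation′ n → Set
IsBlock a b π = ∀ i → Block a b (toℕ i) (toℕ (π ⟨$⟩ʳ i))

module _ {n : ℕ} where

  private
    arrange : ∀ a b → a + b ≤ n → Fin n → Fin n
    arrange a b a+b≤n i =
      fromℕ< (block-bounded a+b≤n (toℕ<n i) (proj₂ (block-image a b (toℕ i))))

    arrange-block : ∀ a b (a+b≤n : a + b ≤ n) i → Block a b (toℕ i) (toℕ (arrange a b a+b≤n i))
    arrange-block a b a+b≤n i =
      block-respʳ (sym (toℕ-fromℕ< _)) (proj₂ (block-image a b (toℕ i)))

    arrange-inverse : ∀ a b a+b≤n b+a≤n i → arrange a b a+b≤n (arrange b a b+a≤n i) ≡ i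
    arrange-inverse a b a+b≤n b+a≤n i = toℕ-injective
      (block-functional (arrange-block a b a+b≤n _)
        (block-swap (arrange-block b a b+a≤n i)))

  blockPermutation : ∀ a b → a + b ≤ n → Permutation′ n
  blockPermutation a b a+b≤n = permutation (arrange a b a+b≤n) (arrange b a b+a≤n)
    (arrange-inverse a b a+b≤n b+a≤n) (arrange-inverse b a b+a≤n a+b≤n)
    where b+a≤n = +-comm-≤ a b a+b≤n

  blockPermutation-isBlock : ∀ a b (a+b≤n : a + b ≤ n) → IsBlock a b (blockPermutation a b a+b≤n)
  blockPermutation-isBlock = arrange-block

module _ (π : Permutation′ n) (B : IsBlock a b π) where

  -- The 32 is an inversion, so its 3 is in the first block and its 2 has a value below `b`. The 1
  -- stands further left, again in the first block, hence its value is at least `b`, yet it is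
  -- smaller than the 2.
  isBlock⇒avoids132 : π Avoids p132
  isBlock⇒avoids132 (i , inc , iso)
    with block-inversion (B (i 1F)) (B (i 2F)) (inc 1F 2F (s≤s (s≤s z≤n)))
           (Equivalence.from (iso 2F 1F) (s≤s (s≤s z≤n)))
  ... | i₁<a , v₂<b = contradiction
    (<-trans (Equivalence.from (iso 0F 2F) (s≤s z≤n)) v₂<b)
    (≤⇒≯ (block-low (<-trans (inc 0F 1F (s≤s z≤n)) i₁<a) (B (i 0F))))

  -- The middle entry ends one inversion and starts another, so its value is below `b` while its
  -- position is before `a`.
  isBlock⇒avoids321 : π Avoids p321
  isBlock⇒avoids321 (i , inc , iso)
    with block-inversion (B (i 0F)) (B (i 1F)) (inc 0F 1F (s≤s z≤n))
           (Equivalence.from (iso 1F 0F) (s≤s (s≤s z≤n)))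
       | block-inversion (B (i 1F)) (B (i 2F)) (inc 1F 2F (s≤s (s≤s z≤n)))
           (Equivalence.from (iso 2F 1F) (s≤s z≤n))
  ... | _ , v₁<b | i₁<a , _ = contradiction v₁<b (≤⇒≯ (block-low i₁<a (B (i 1F))))

-- Avoiders of both patterns are block permutations

private
  triple : {A : Set} → A → A → A → Fin 3 → A
  triple x y z 0F = x
  triple x y z 1F = y
  triple x y z 2F = z

module _ (π : Permutation′ n) {i j k : Fin n} (i<j : i Fin.< j) (j<k : j Fin.< k) where

  private
    increasing : ∀ x y → x Fin.< y → triple i j k x Fin.< triple i j k y
    increasing 0F 1F _ = i<j
    increasing 0F 2F _ = <-trans i<j j<k
    increasing 1F 2F _ = j<k
    increasing 0F 0F ()
    increasing 1F 0F ()
    increasing 2F 0F ()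
    increasing 1F 1F (s≤s ())
    increasing 2F 1F (s≤s ())
    increasing 2F 2F (s≤s (s≤s ()))

    -- One direction of the order isomorphism suffices: by trichotomy for the values of `ρ`, which
    -- is injective, the other follows.
    contains : (ρ : Permutation′ 3) →
      (∀ x y → ρ ⟨$⟩ʳ x Fin.< ρ ⟨$⟩ʳ y → π ⟨$⟩ʳ triple i j k x Fin.< π ⟨$⟩ʳ triple i j k y) →
      π Contains ρ
    contains ρ mono = triple i j k , increasing , λ x y → mk⇔ (reflects x y) (mono x y)
      where
      reflects : ∀ x y → π ⟨$⟩ʳ triple i j k x Fin.< π ⟨$⟩ʳ triple i j k y → ρ ⟨$⟩ʳ x Fin.< ρ ⟨$⟩ʳ y
      reflects x y lt with <-cmp (toℕ (ρ ⟨$⟩ʳ x)) (toℕ (ρ ⟨$⟩ʳ y))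
      ... | tri< ρx<ρy _ _ = ρx<ρy
      ... | tri> _ _ ρy<ρx = contradiction lt (<-asym (mono y x ρy<ρx))
      ... | tri≈ _ eq _ with refl ← Injection.injective (↔⇒↣ ρ) (toℕ-injective eq) =
        contradiction lt (<-irrefl refl)

  contains132 : π ⟨$⟩ʳ i Fin.< π ⟨$⟩ʳ k → π ⟨$⟩ʳ k Fin.< π ⟨$⟩ʳ j → π Contains p132
  contains132 πi<πk πk<πj = contains p132 λ where
    0F 1F _ → <-trans πi<πk πk<πj
    0F 2F _ → πi<πk
    2F 1F _ → πk<πj
    0F 0F ()
    1F 0F ()
    2F 0F ()
    1F 1F (s≤s (s≤s ()))
    1F 2F (s≤s ())
    2F 2F (s≤s ())

  contains321 : π ⟨$⟩ʳ k Fin.< π ⟨$⟩ʳ j → π ⟨$⟩ʳ j Fin.< π ⟨$⟩ʳ i → π Contains p321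
  contains321 πk<πj πj<πi = contains p321 λ where
    2F 1F _ → πk<πj
    2F 0F _ → <-trans πk<πj πj<πi
    1F 0F _ → πj<πi
    0F 0F (s≤s (s≤s ()))
    0F 1F (s≤s ())
    0F 2F ()
    1F 1F (s≤s ())
    1F 2F ()
    2F 2F ()

permutation-injective : (π : Permutation′ n) {i j : Fin n} → π ⟨$⟩ʳ i ≡ π ⟨$⟩ʳ j → i ≡ j
permutation-injective π = Injection.injective (↔⇒↣ π)

-- The largest value of the second block, one below the second parameter, is attained somewhere. The
-- graph puts it at the last position of that block, which must therefore be a position of `π`.
isBlock⇒bounded : (π : Permutation′ n) → IsBlock a b π → a ≤ n → b ≤ n → a + b ≤ n
isBlock⇒bounded {n} {a} {zero}  π B a≤n b≤n = subst (_≤ n) (sym (+-identityʳ a)) a≤n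
isBlock⇒bounded {n} {a} {suc b} π B a≤n b<n =
  subst (_≤ n) (trans (cong suc q≡a+b) (sym (+-suc a b))) (toℕ<n q)
  where
  q = π ⟨$⟩ˡ fromℕ< b<n
  πq≡b : toℕ (π ⟨$⟩ʳ q) ≡ b
  πq≡b = trans (cong toℕ (inverseʳ π)) (toℕ-fromℕ< b<n)
  q≡a+b : toℕ q ≡ a + b
  q≡a+b = block-injective (block-respʳ πq≡b (B q)) (mid ≤-refl refl)

module _ (π : Permutation′ (suc n)) (avoids132 : π Avoids p132) (avoids321 : π Avoids p321) where

  private
    s : Fin (suc n)
    s = π ⟨$⟩ˡ 0F

    pos val : ℕ
    pos = toℕ s
    val = toℕ (π ⟨$⟩ʳ 0F)

    πs≡0 : toℕ (π ⟨$⟩ʳ s) ≡ 0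
    πs≡0 = cong toℕ (inverseʳ π)

    pos≡0⇒val≡0 : pos ≡ 0 → val ≡ 0
    pos≡0⇒val≡0 pos≡0 =
      trans (cong (toℕ ∘ (π ⟨$⟩ʳ_)) (sym (toℕ-injective {j = 0F} pos≡0))) πs≡0

    val≡0⇒pos≡0 : val ≡ 0 → pos ≡ 0
    val≡0⇒pos≡0 val≡0 = cong toℕ (permutation-injective π {s} {0F} (toℕ-injective (trans πs≡0 (sym val≡0))))

    -- pos + val ≤ suc n is only known once π is known to be a block permutation.
    V : Valid (pos + val) pos val
    V = record
      { bounded = ≤-refl
      ; a>0⇒b>0 = λ pos>0 → n≢0⇒n>0 (m<n⇒n≢0 pos>0 ∘ val≡0⇒pos≡0)
      ; b>0⇒a>0 = λ val>0 → n≢0⇒n>0 (m<n⇒n≢0 val>0 ∘ pos≡0⇒val≡0)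
      }

    -- Induction on the position. Positions 0 and `pos` are right by the choice of `val` and `pos`.
    -- Elsewhere let `t` be the value that the graph prescribes and `u` the actual one: `u > t`
    -- would create a 132, and `u < t` either creates a 321 or repeats a value from further left.
    go : ∀ i → Acc Fin._<_ i → Block pos val (toℕ i) (toℕ (π ⟨$⟩ʳ i))
    go i (acc rec) with toℕ i ≟ 0 | toℕ i ≟ pos
    ... | yes i≡0 | _ with refl ← toℕ-injective {j = 0F} i≡0 = first-value V
    ... | no _ | yes i≡pos with refl ← toℕ-injective i≡pos =
      block-respʳ (sym πs≡0) (position-of-0 V)
    ... | no i≢0 | no i≢pos = cases (block-image pos val (toℕ i))
      where
      u : ℕ
      u = toℕ (π ⟨$⟩ʳ i)

      i>0 : 0 < toℕ i
      i>0 = n≢0⇒n>0 i≢0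

      -- By the induction hypothesis `w` is already the value at position `j`, so injectivity of `π`
      -- excludes it at `i`.
      not-earlier : ∀ {j} → j < toℕ i → Block pos val j w → u ≢ w
      not-earlier {w} {j} j<i B u≡w = <-irrefl (cong toℕ j′≡i) j′<i
        where
        j<1+n = <-trans j<i (toℕ<n i)
        j′ = fromℕ< j<1+n
        j′<i : j′ Fin.< i
        j′<i = subst (_< toℕ i) (sym (toℕ-fromℕ< j<1+n)) j<i
        j′≡i : j′ ≡ i
        j′≡i = permutation-injective π (toℕ-injective (trans
          (block-functional (block-respˡ (toℕ-fromℕ< j<1+n) (go j′ (rec j′<i))) B)
          (sym u≡w)))

      -- If u > t, the value t lies to the right of i and completes a 132 with x and i.
      at-most : ∀ {t} (x : Fin (suc n)) → x Fin.< i → toℕ (π ⟨$⟩ʳ x) < t →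
                Block pos val (toℕ i) t → u ≤ t
      at-most {t} x x<i πx<t B = ≮⇒≥ absurd
        where
        absurd : ¬ (t < u)
        absurd t<u = by-position (<-cmp (toℕ q) (toℕ i))
          where
          t<1+n = <-trans t<u (toℕ<n (π ⟨$⟩ʳ i))
          q = π ⟨$⟩ˡ fromℕ< t<1+n
          πq≡t : toℕ (π ⟨$⟩ʳ q) ≡ t
          πq≡t = trans (cong toℕ (inverseʳ π)) (toℕ-fromℕ< t<1+n)
          by-position : ¬ Tri (toℕ q < toℕ i) (toℕ q ≡ toℕ i) (toℕ i < toℕ q)
          by-position (tri< q<i _ _) =
            <-irrefl (block-injective (block-respʳ πq≡t (go q (rec q<i))) B) q<i
          by-position (tri≈ _ q≡i _) =
            <-irrefl (trans (sym πq≡t) (cong (toℕ ∘ (π ⟨$⟩ʳ_)) (toℕ-injective q≡i))) t<u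
          by-position (tri> _ _ i<q) = avoids132
            (contains132 π x<i i<q (subst (_ <_) (sym πq≡t) πx<t) (subst (_< u) (sym πq≡t) t<u))

      conclude : ∀ {t} → Block pos val (toℕ i) t → u ≤ t → ¬ (u < t) → Block pos val (toℕ i) u
      conclude B u≤t u≮t = block-respʳ (≤-antisym (≮⇒≥ u≮t) u≤t) B

      cases : ∃ (Block pos val (toℕ i)) → Block pos val (toℕ i) u
      -- The entry `val` at position 0 is the 1 of the 132. If `u < val`, then `val`, `u`, 0 form a
      -- 321; if `val ≤ u < t`, the graph places `u` at position `u ∸ val`, left of `i`.
      cases (t , B@(low i<pos refl)) =
        conclude B (at-most 0F i>0 (m<m+n val i>0) B) λ u<t → by-value u<t (val ≤? u)
        where
        u≢0 : u ≢ 0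
        u≢0 u≡0 = i≢pos (cong toℕ (permutation-injective π (toℕ-injective (trans u≡0 (sym πs≡0)))))
        by-value : u < val + toℕ i → ¬ Dec (val ≤ u)
        by-value u<t (no val≰u) = avoids321
          (contains321 π {0F} i>0 i<pos (subst (_< u) (sym πs≡0) (n≢0⇒n>0 u≢0)) (≰⇒> val≰u))
        by-value u<t (yes val≤u) = not-earlier u∸val<i
          (low (<-trans u∸val<i i<pos) (m+[n∸m]≡n val≤u)) refl
          where
          u∸val<i : u ∸ val < toℕ i
          u∸val<i = +-cancelˡ-< val _ _ (subst (_< val + toℕ i) (sym (m+[n∸m]≡n val≤u)) u<t)
      -- Now the value 0 at `s` is the 1 of the 132, and a smaller `u` belongs at position
      -- `pos + u`, left of `i`.
      cases (t , B@(mid t<val pos+t≡i)) =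
        conclude B (at-most s pos<i (subst (_< t) (sym πs≡0) t>0) B) λ u<t →
          not-earlier (subst (pos + u <_) pos+t≡i (+-monoʳ-< pos u<t)) (mid (<-trans u<t t<val) refl) refl
        where
        pos<i : pos < toℕ i
        pos<i = ≤∧≢⇒< (subst (pos ≤_) pos+t≡i (m≤m+n pos t)) (i≢pos ∘ sym)
        t>0 : 0 < t
        t>0 = +-cancelˡ-< pos 0 t (subst₂ _<_ (sym (+-identityʳ pos)) (sym pos+t≡i) pos<i)
      -- Since `pos + val ≤ i`, the inverse graph maps numbers below `i` to numbers below `i`, so
      -- every `u < i` belongs left of `i`.
      cases (t , B@(high pos+val≤i refl)) =
        conclude B (at-most s pos<i (subst (_< t) (sym πs≡0) i>0) B) λ u<i →
          let j , B′ = block-image val pos u in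
          not-earlier (block-bounded (+-comm-≤ pos val pos+val≤i) u<i B′) (block-swap B′) refl
        where
        pos<i : pos < toℕ i
        pos<i = ≤∧≢⇒< (m+n≤o⇒m≤o pos pos+val≤i) (i≢pos ∘ sym)

    πʳ-isBlock : IsBlock pos val π
    πʳ-isBlock i = go i (<-wellFounded i)

  avoids⇒isBlock : ∃₂ λ a b → Valid (suc n) a b × IsBlock a b π
  avoids⇒isBlock = pos , val , record
    { bounded = isBlock⇒bounded π πʳ-isBlock (<⇒≤ (toℕ<n s)) (<⇒≤ (toℕ<n (π ⟨$⟩ʳ 0F)))
    ; a>0⇒b>0 = a>0⇒b>0 V
    ; b>0⇒a>0 = b>0⇒a>0 V
    } , πʳ-isBlock

-- Double ascents of a block permutation

-- A double ascent starting at `i` is spoiled exactly when `i + 1` or `i + 2` is the position `a`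
-- where the descent ends. This leaves `a ∸ 2` starting points before the gap and `m ∸ a` after it;
-- truncation handles `a = 0` and `a = 1`, where the gap is cut off on the left. The recursion
-- shifts the list and lowers `a` together, until `a` is 0.
length-filter-tabulate : {A : Set} {P : Pred A 0ℓ} (P? : Decidable P) (f : Fin m → A) →
  ∀ a → a ≤ suc m →
  (∀ i → suc (toℕ i) ≢ a → 2 + toℕ i ≢ a → P (f i)) →
  (∀ i → P (f i) → suc (toℕ i) ≢ a × 2 + toℕ i ≢ a) →
  length (filter P? (tabulate f)) ≡ (a ∸ 2) + (m ∸ a)
length-filter-tabulate {zero} P? f 0 _ _ _ = refl
length-filter-tabulate {zero} P? f 1 _ _ _ = refl
length-filter-tabulate {zero} P? f (suc (suc a)) (s≤s ()) _ _
length-filter-tabulate {suc m} P? f 0 _ holds _ = trans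
  (cong length (filter-accept P? (holds 0F (λ ()) (λ ()))))
  (cong suc (length-filter-tabulate P? (f ∘ Fin.suc) 0 z≤n
    (λ i _ _ → holds (Fin.suc i) (λ ()) (λ ())) (λ _ _ → (λ ()) , (λ ()))))
length-filter-tabulate {suc m} P? f 1 _ holds fails = trans
  (cong length (filter-reject P? (λ p → proj₁ (fails 0F p) refl)))
  (length-filter-tabulate P? (f ∘ Fin.suc) 0 z≤n
    (λ i _ _ → holds (Fin.suc i) (λ ()) (λ ())) (λ _ _ → (λ ()) , (λ ())))
length-filter-tabulate {suc m} P? f 2 _ holds fails = trans
  (cong length (filter-reject P? (λ p → proj₂ (fails 0F p) refl)))
  (length-filter-tabulate P? (f ∘ Fin.suc) 1 (s≤s z≤n)
    (λ i ≢₁ ≢₂ → holds (Fin.suc i) (≢₁ ∘ suc-injective) (≢₂ ∘ suc-injective))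
    (λ i p → (proj₁ (fails (Fin.suc i) p) ∘ cong suc) , (proj₂ (fails (Fin.suc i) p) ∘ cong suc)))
length-filter-tabulate {suc m} P? f (suc (suc (suc a))) (s≤s a≤m) holds fails = trans
  (cong length (filter-accept P? (holds 0F (λ ()) (λ ()))))
  (cong suc (length-filter-tabulate P? (f ∘ Fin.suc) (suc (suc a)) a≤m
    (λ i ≢₁ ≢₂ → holds (Fin.suc i) (≢₁ ∘ suc-injective) (≢₂ ∘ suc-injective))
    (λ i p → (proj₁ (fails (Fin.suc i) p) ∘ cong suc) , (proj₂ (fails (Fin.suc i) p) ∘ cong suc))))

-- A descent to position `suc i` is an inversion, so `i < a` and `w < b`. In the swapped graph the
-- latter gives `a ≤ suc i`, which leaves only `suc i ≡ a`.
block-ascent : Valid n a b → Block a b i v → Block a b (suc i) w → suc i ≢ a → v < w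
block-ascent {i = i} {v} {w} V B B′ 1+i≢a with <-cmp v w
... | tri< v<w _ _ = v<w
... | tri≈ _ refl _ = contradiction (block-injective B B′) (<⇒≢ ≤-refl)
... | tri> _ _ w<v with block-inversion B B′ ≤-refl w<v
...   | i<a , w<b = contradiction (≤-antisym i<a (block-low w<b (block-swap B′))) 1+i≢a

-- The value at position `a` is 0, and no ascent ends in 0.
block-descent : Valid n a b → Block a b i v → Block a b (suc i) w → v < w → suc i ≢ a
block-descent V B B′ v<w refl
  with refl ← block-functional (position-of-0 V) B′ = contradiction v<w λ ()

dasc-isBlock : (π : Permutation′ (2 + m)) → Valid (2 + m) a b → IsBlock a b π →
               dasc π ≡ (a ∸ 2) + (m ∸ a)
dasc-isBlock {m} {a} {b} π V B = length-filter-tabulate _ (λ i → i) a a≤1+m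
  (λ i ≢₁ ≢₂ → block-ascent V (B₀ i) (B₁ i) ≢₁ , block-ascent V (B₁ i) (B (Fin.suc (Fin.suc i))) ≢₂)
  (λ i (<₁ , <₂) → block-descent V (B₀ i) (B₁ i) <₁ , block-descent V (B₁ i) (B (Fin.suc (Fin.suc i))) <₂)
  where
  B₀ : ∀ i → Block a b (toℕ i) (toℕ (π ⟨$⟩ʳ inject₁ (inject₁ i)))
  B₀ i = block-respˡ (trans (toℕ-inject₁ (inject₁ i)) (toℕ-inject₁ i)) (B _)
  B₁ : ∀ i → Block a b (suc (toℕ i)) (toℕ (π ⟨$⟩ʳ Fin.suc (inject₁ i)))
  B₁ i = block-respˡ (cong suc (toℕ-inject₁ i)) (B _)
  a≤1+m : a ≤ suc m
  a≤1+m with 0 <? a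
  -- A nonempty first block forces a nonempty second one, so `a < a + b ≤ 2 + m`.
  ... | yes a>0 = s≤s⁻¹ (<-≤-trans (m<m+n a (a>0⇒b>0 V a>0)) (bounded V))
  ... | no a≯0 = ≤-trans (≮⇒≥ a≯0) z≤n

-- Reduction to counting parameter pairs

-- Together with `isBlock⇒position-of-0` this recovers both parameters from the permutation, which
-- makes the parametrization injective.
isBlock⇒first-value : (π : Permutation′ (suc n)) → Valid (suc n) a b → IsBlock a b π →
                      toℕ (π ⟨$⟩ʳ 0F) ≡ b
isBlock⇒first-value π V B = block-functional (B 0F) (first-value V)

isBlock⇒position-of-0 : (π : Permutation′ (suc n)) → Valid (suc n) a b → IsBlock a b π →
                        ∀ {x} → π ⟨$⟩ʳ x ≡ 0F → toℕ x ≡ a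
isBlock⇒position-of-0 {a = a} {b} π V B {x} πx≡0 =
  block-injective (block-respʳ (cong toℕ πx≡0) (B x)) (position-of-0 V)

module _ {I : Set} (a b : I → ℕ)
  (valid-ab : ∀ i → Valid (2 + m) (a i) (b i))
  (ab-injective : ∀ i j → a i ≡ a j → b i ≡ b j → i ≡ j)
  (dasc-ab : ∀ i → (a i ∸ 2) + (m ∸ a i) ≡ k)
  (ab-surjective : ∀ {x y} → Valid (2 + m) x y → (x ∸ 2) + (m ∸ x) ≡ k → ∃ λ i → a i ≡ x × b i ≡ y)
  where

  -- Every avoider is the block permutation of exactly one valid pair, so any type `I` that lists
  -- without repetition the valid pairs yielding `k` double ascents counts the avoiders. The
  -- bijection is built starting from `I`, where equality is propositional and congruence is
  -- immediate.
  avoiders↔index : Inverse (AvoidersWithDasc p132 p321 (2 + m) k) (setoid I)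
  avoiders↔index = Inverse-sym (Bijection⇒Inverse record
    { to = λ i → let B = isBlock i in
        π i , isBlock⇒avoids132 (π i) B , isBlock⇒avoids321 (π i) B ,
        trans (dasc-isBlock (π i) (valid-ab i) B) (dasc-ab i)
    ; cong = λ where refl x → refl
    ; bijective = injective , surjective
    })
    where
    π : I → Permutation′ (2 + m)
    π i = blockPermutation (a i) (b i) (bounded (valid-ab i))
    isBlock : ∀ i → IsBlock (a i) (b i) (π i)
    isBlock i = blockPermutation-isBlock (a i) (b i) (bounded (valid-ab i))
    injective : ∀ {i j} → (∀ x → π i ⟨$⟩ʳ x ≡ π j ⟨$⟩ʳ x) → i ≡ j
    injective {i} {j} πi≈πj = ab-injective i j
      (trans (sym (isBlock⇒position-of-0 (π i) (valid-ab i) (isBlock i) (inverseʳ (π i))))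
        (isBlock⇒position-of-0 (π j) (valid-ab j) (isBlock j)
          (trans (sym (πi≈πj (π i ⟨$⟩ˡ 0F))) (inverseʳ (π i)))))
      (trans (sym (isBlock⇒first-value (π i) (valid-ab i) (isBlock i)))
        (trans (cong toℕ (πi≈πj 0F))
          (isBlock⇒first-value (π j) (valid-ab j) (isBlock j))))
    surjective : ∀ ((ρ , _) : Setoid.Carrier (AvoidersWithDasc p132 p321 (2 + m) k)) →
                 ∃ λ i → ∀ {j} → j ≡ i → ∀ x → π j ⟨$⟩ʳ x ≡ ρ ⟨$⟩ʳ x
    surjective (ρ , avoids132 , avoids321 , dasc≡k)
      with x , y , V , B ← avoids⇒isBlock ρ avoids132 avoids321
      with i , refl , refl ← ab-surjective V (trans (sym (dasc-isBlock ρ V B)) dasc≡k)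
      = i , λ where refl x → toℕ-injective (block-functional (isBlock i x) (B x))

-- The last index is the number of double ascents for n = 3 + p.
data Shape : ℕ → ℕ → ℕ → ℕ → Set where
  identity : Shape p 0 0 (suc p)
  first    : b < 2 + p → Shape p 1 (suc b) p
  last     : Shape p (2 + p) 1 p
  middle   : ∀ a e → b ≤ suc e → Shape (suc (a + e)) (2 + a) (suc b) (a + e)

private
  -- If `p = a`, the second run has length 1, the subtraction truncates to 0 and the bound forces
  -- `b = 0`: this is `last`. Otherwise `p = a + suc e`, both runs have length at least 2, and one
  -- more double ascent is lost.
  shape-middle : ∀ a → a + b ≤ p → Shape p (2 + a) (suc b) (a + (p ∸ suc a))
  shape-middle {b} a a+b≤p with m≤n⇒∃[o]m+o≡n (m+n≤o⇒m≤o a a+b≤p)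
  ... | 0 , refl
    rewrite +-identityʳ a | n≤0⇒n≡0 (+-cancelˡ-≤ a b 0 (≤-trans a+b≤p (≤-reflexive (sym (+-identityʳ a)))))
          | m≤n⇒m∸n≡0 (n≤1+n a) | +-identityʳ a = last
  ... | suc e , refl with b≤1+e ← +-cancelˡ-≤ a b (suc e) a+b≤p
    rewrite +-suc a e | m+n∸m≡n a e = middle a e b≤1+e

shape : Valid (3 + p) a b → Shape p a b ((a ∸ 2) + (suc p ∸ a))
shape {a = 0} {0} V = identity
shape {a = 0} {suc b} V = contradiction (b>0⇒a>0 V z<s) λ ()
shape {a = suc a} {0} V = contradiction (a>0⇒b>0 V z<s) λ ()
shape {a = 1} {suc b} V = first (s≤s⁻¹ (bounded V))
shape {a = suc (suc a)} {suc b} V = 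
  shape-middle a (s≤s⁻¹ (≤-trans (≤-reflexive (sym (+-suc a b))) (s≤s⁻¹ (s≤s⁻¹ (bounded V)))))

-- Cardinalities of the index types

Fin-sum↔ : ∀ n (f : Fin n → ℕ) → Σ (Fin n) (Fin ∘ f) ↔ Fin (Vector.foldr _+_ 0 f)
Fin-sum↔ zero    f = mk↔ₛ′ (λ ()) (λ ()) (λ ()) (λ ())
Fin-sum↔ (suc n) f =
  ↔-trans unfold (↔-trans (↔-refl ⊎-↔ Fin-sum↔ n (f ∘ Fin.suc)) (↔-sym +↔⊎))
  where
  unfold : Σ (Fin (suc n)) (Fin ∘ f) ↔ (Fin (f 0F) ⊎ Σ (Fin n) (Fin ∘ f ∘ Fin.suc))
  unfold = mk↔ₛ′
    (λ where (0F , j) → inj₁ j ; (Fin.suc i , j) → inj₂ (i , j))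
    (λ where (inj₁ j) → 0F , j ; (inj₂ (i , j)) → Fin.suc i , j)
    (λ where (inj₁ j) → refl ; (inj₂ (i , j)) → refl)
    (λ where (0F , j) → refl ; (Fin.suc i , j) → refl)

-- For n = k + 4 the terms are n - 2, ..., 2, that is, 1, ..., n - 1 without 1 and n - 1; adding n
-- restores these two. Dropping the first term of the sum for `suc k` leaves by computation the sum
-- for `k`, so the induction step is Pascal's rule.
triangular : ∀ k → Vector.foldr _+_ 0 {suc k} (λ i → 2 + (k ∸ toℕ i)) + (4 + k) ≡ (4 + k) C 2
triangular zero = refl
triangular (suc k) = begin
  (3 + k + t) + (5 + k)      ≡⟨ rearrange k t ⟩
  (4 + k) + (t + (4 + k))    ≡⟨ cong (4 + k +_) (triangular k) ⟩
  (4 + k) + (4 + k) C 2      ≡⟨ cong (_+ (4 + k) C 2) (nC1≡n (4 + k)) ⟨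
  (4 + k) C 1 + (4 + k) C 2  ≡⟨ nCk+nC[k+1]≡[n+1]C[k+1] (4 + k) 1 ⟩
  (5 + k) C 2                ∎
  where
  open ≡-Reasoning
  t = Vector.foldr _+_ 0 {suc k} (λ i → 2 + (k ∸ toℕ i))
  rearrange : ∀ k t → (3 + k + t) + (5 + k) ≡ (4 + k) + (t + (4 + k))
  rearrange = solve-∀

-- The four cases of the formula

AvoidersCount : ℕ → ℕ → ℕ → Set
AvoidersCount n k c = AvoidersWithDasc p132 p321 n k HasCardinality c

count[n-2] : ∀ p → AvoidersCount (3 + p) (suc p) 1
count[n-2] p = avoiders↔index (λ _ → 0) (λ _ → 0)
  (λ _ → valid z≤n (λ ()) (λ ())) (λ where 0F 0F _ _ → refl) (λ _ → refl)
  (λ V → only (shape V))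
  where
  only : ∀ {x y d} → Shape p x y d → d ≡ suc p → ∃ λ (i : Fin 1) → 0 ≡ x × 0 ≡ y
  only identity       _  = 0F , refl , refl
  only (first _)      eq = contradiction eq (<⇒≢ ≤-refl)
  only last           eq = contradiction eq (<⇒≢ ≤-refl)
  only (middle _ _ _) eq = contradiction eq (<⇒≢ (s≤s (n≤1+n _)))

-- One of the two runs has length 1. Index `0F` stands for the pair (n - 1, 1), the others for the n
-- - 1 pairs (1, b) with 1 ≤ b ≤ n - 1.
count[n-3] : ∀ p → AvoidersCount (3 + p) p (3 + p)
count[n-3] p = avoiders↔index α β valid-αβ injective dasc-αβ (λ V → surjective (shape V))
  where
  α β : Fin (3 + p) → ℕ
  α 0F          = 2 + p
  α (Fin.suc i) = 1
  β 0F          = 1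
  β (Fin.suc i) = suc (toℕ i)
  valid-αβ : ∀ i → Valid (3 + p) (α i) (β i)
  valid-αβ 0F          = valid (≤-reflexive (+-comm (2 + p) 1)) (λ _ → z<s) (λ _ → z<s)
  valid-αβ (Fin.suc i) = valid (s≤s (toℕ<n i)) (λ _ → z<s) (λ _ → z<s)
  injective : ∀ i j → α i ≡ α j → β i ≡ β j → i ≡ j
  injective 0F          0F          _ _  = refl
  injective (Fin.suc i) (Fin.suc j) _ eq = cong Fin.suc (toℕ-injective (suc-injective eq))
  dasc-αβ : ∀ i → (α i ∸ 2) + (suc p ∸ α i) ≡ p
  dasc-αβ 0F          = trans (cong (p +_) (m≤n⇒m∸n≡0 (n≤1+n p))) (+-identityʳ p)
  dasc-αβ (Fin.suc i) = refl
  surjective : ∀ {x y d} → Shape p x y d → d ≡ p → ∃ λ i → α i ≡ x × β i ≡ y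
  surjective identity       eq = contradiction (sym eq) (<⇒≢ ≤-refl)
  surjective (first β<2+p)  _  = Fin.suc (fromℕ< β<2+p) , refl , cong suc (toℕ-fromℕ< β<2+p)
  surjective last           _  = 0F , refl , refl
  surjective (middle _ _ _) eq = contradiction eq (<⇒≢ ≤-refl)

-- Both runs have length at least 2, so 2 ≤ a ≤ n - 2, and for each such a the parameter b ranges
-- over 1, ..., n - a. With a = 2 + i these are `size i` choices.
count[n-4] : ∀ k → AvoidersCount (4 + k) k ((4 + k) C 2 ∸ (4 + k))
count[n-4] k = subst (AvoidersCount (4 + k) k) size≡
  (inverse (avoiders↔index α β valid-αβ injective dasc-αβ (λ V → surjective (shape V) refl)) (Fin-sum↔ _ size))
  where
  size : Fin (suc k) → ℕ
  size i = 2 + (k ∸ toℕ i)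
  size≡ : Vector.foldr _+_ 0 size ≡ (4 + k) C 2 ∸ (4 + k)
  size≡ = trans (sym (m+n∸n≡m _ (4 + k))) (cong (_∸ (4 + k)) (triangular k))
  α β : Σ (Fin (suc k)) (Fin ∘ size) → ℕ
  α (i , _) = 2 + toℕ i
  β (_ , j) = suc (toℕ j)
  i≤k : ∀ (i : Fin (suc k)) → toℕ i ≤ k
  i≤k i = s≤s⁻¹ (toℕ<n i)
  valid-αβ : ∀ i → Valid (4 + k) (α i) (β i)
  valid-αβ (i , j) = valid
    (s≤s (s≤s (≤-trans (+-monoʳ-≤ (toℕ i) (toℕ<n j)) (≤-reflexive i+size≡2+k))))
    (λ _ → z<s) (λ _ → z<s)
    where
    i+size≡2+k : toℕ i + size i ≡ 2 + k
    i+size≡2+k = trans (+-suc (toℕ i) _) (cong suc (trans (+-suc (toℕ i) _) (cong suc (m+[n∸m]≡n (i≤k i)))))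
  injective : ∀ i j → α i ≡ α j → β i ≡ β j → i ≡ j
  injective (i , _) (i′ , _) α≡ β≡ with refl ← toℕ-injective {i = i} {j = i′} (+-cancelˡ-≡ 2 _ _ α≡)
    = cong (i ,_) (toℕ-injective (suc-injective β≡))
  dasc-αβ : ∀ i → (α i ∸ 2) + (2 + k ∸ α i) ≡ k
  dasc-αβ (i , _) = m+[n∸m]≡n (i≤k i)
  surjective : ∀ {x y p d} → Shape p x y d → p ≡ suc k → d ≡ k → ∃ λ i → α i ≡ x × β i ≡ y
  surjective identity  refl eq = contradiction (sym eq) (<⇒≢ (s≤s (n≤1+n _)))
  surjective (first _) refl eq = contradiction (sym eq) (<⇒≢ ≤-refl)
  surjective last      refl eq = contradiction (sym eq) (<⇒≢ ≤-refl)
  surjective (middle {b} a e b≤1+e) _ refl =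
    (i₀ , fromℕ< b<size) , cong (2 +_) (toℕ-fromℕ< a<1+k) , cong suc (toℕ-fromℕ< b<size)
    where
    a<1+k : a < suc (a + e)
    a<1+k = s≤s (m≤m+n a e)
    i₀ = fromℕ< a<1+k
    size≡2+e : 2 + e ≡ size i₀
    size≡2+e = cong (2 +_) (sym (trans (cong (k ∸_) (toℕ-fromℕ< a<1+k)) (m+n∸m≡n a e)))
    b<size : b < size i₀
    b<size = <-≤-trans (s≤s b≤1+e) (≤-reflexive size≡2+e)

-- The empty type is the index, since a `Shape` admits only the three other counts. The condition
-- `suc k ≢ p` says k ≠ n - 4 without a subtraction that could truncate.
count-otherwise : ∀ p k → k ≢ suc p → k ≢ p → suc k ≢ p → AvoidersCount (3 + p) k 0
count-otherwise p k ≢₁ ≢₂ ≢₃ = avoiders↔index (λ ()) (λ ()) (λ ()) (λ ()) (λ ())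
  (λ V eq → contradiction eq (impossible (shape V) ≢₁ ≢₂ ≢₃))
  where
  impossible : ∀ {x y p d} → Shape p x y d → k ≢ suc p → k ≢ p → suc k ≢ p → d ≢ k
  impossible identity       ≢₁ _  _  = ≢₁ ∘ sym
  impossible (first _)      _  ≢₂ _  = ≢₂ ∘ sym
  impossible last           _  ≢₂ _  = ≢₂ ∘ sym
  impossible (middle _ _ _) _  _  ≢₃ = ≢₃ ∘ cong suc ∘ sym

proposition22 : ∀ (n k : ℕ) → 3 ≤ n →
    (k + 2 ≡ n → AvoidersWithDasc p132 p321 n k HasCardinality 1)
    × (k + 3 ≡ n → AvoidersWithDasc p132 p321 n k HasCardinality n)
    × (k + 4 ≡ n → AvoidersWithDasc p132 p321 n k HasCardinality ((n C 2) ∸ n))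
    × (k + 2 ≢ n → k + 3 ≢ n → k + 4 ≢ n → AvoidersWithDasc p132 p321 n k HasCardinality 0)
proposition22 (suc (suc (suc p))) k (s≤s (s≤s (s≤s _))) =
    k≡n-2 , k≡n-3 , k≡n-4
  , λ k+2≢n k+3≢n k+4≢n → count-otherwise p k
      (λ { refl → k+2≢n (+-comm (suc p) 2) })
      (λ { refl → k+3≢n (+-comm p 3) })
      (λ { refl → k+4≢n (+-comm k 4) })
  where
  k≡n-2 : k + 2 ≡ 3 + p → AvoidersCount (3 + p) k 1
  k≡n-2 eq with refl ← +-cancelʳ-≡ 2 k (suc p) (trans eq (+-comm 2 (suc p))) = count[n-2] p
  k≡n-3 : k + 3 ≡ 3 + p → AvoidersCount (3 + p) k (3 + p)
  k≡n-3 eq with refl ← +-cancelʳ-≡ 3 k p (trans eq (+-comm 3 p)) = count[n-3] p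
  k≡n-4 : k + 4 ≡ 3 + p → AvoidersCount (3 + p) k ((3 + p) C 2 ∸ (3 + p))
  -- Unification strips the common successors from `4 + k ≡ 3 + p` and sets `p` to `suc k`.
  k≡n-4 eq with refl ← trans (+-comm 4 k) eq = count[n-4] k
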